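{- Let $\kappa$ be an infinite cardinal with $\kappa^{<\kappa}=\kappa$, let $\varphi$ be a $\kappa$-scattered linear order type, and let $\nu$ be a cardinal. Then there is a $\kappa$-scattered linear order type $\psi$ such that $\psi\longrightarrow[\varphi]^1_{\nu,\kappa}$.
   Context: A linear order $P$ is $\kappa$-dense if $|P|>1$ and for all $a<_P b$ in $P$ the open interval between $a$ and $b$ in $P$ has cardinality at least $\kappa$. For infinite regular $\kappa$, a linear order (type) is $\kappa$-scattered if it has no $\kappa$-dense suborder. The relation $\psi\longrightarrow[\varphi]^1_{\nu,\kappa}$ means: whenever $P$ is a linear order of type $\psi$ and $f:P\to\nu$ is a function, there are $A\subseteq\nu$ with $|A|\leq\kappa$ and a suborder $Q\subseteq P$ of type $\varphi$ such that $f(q)\in A$ for all $q\in Q$. -}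

module Defs where

open import Level using (Level; suc)
open import Data.Nat.Base using (ℕ)
open import Data.Product using (Σ; Σ-syntax; ∃-syntax; _×_; _,_; proj₁; proj₂)
open import Function.Bundles using (_↣_; _↔_)
open import Induction.WellFounded using (WellFounded)
open import Relation.Binary.Core using (Rel)
open import Relation.Binary.Definitions using (Trichotomous; tri<; tri≈; tri>)
  renaming (Irrelevant to Irrelevant₂)
open import Relation.Binary.Structures using (IsStrictTotalOrder)
open import Relation.Binary.Morphism.Structures using (IsOrderIsomorphism)
open import Relation.Binary.PropositionalEquality
  using (_≡_; _≢_; refl; cong; isEquivalence; resp₂)
open import Relation.Nullary using (¬_)
open import Relation.Unary using (Pred; Irrelevant)

-- Sets are types in a universe Set ℓ.  Membership and order relations are
-- required to be proof-irrelevant, so that the type of elements of a subset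
-- has exactly one inhabitant per element and its cardinality is the right one.

record Subset {ℓ} (A : Set ℓ) : Set (suc ℓ) where
  field
    member     : Pred A ℓ
    irrelevant : Irrelevant member

  Elements : Set ℓ
  Elements = Σ A member

open Subset public using (member; Elements)

record LinearOrder ℓ : Set (suc ℓ) where
  infix 4 _<_
  field
    Carrier            : Set ℓ
    _<_                : Rel Carrier ℓ
    isStrictTotalOrder : IsStrictTotalOrder _≡_ _<_
    <-irrelevant       : Irrelevant₂ _<_

  open IsStrictTotalOrder isStrictTotalOrder public using (compare; trans)

  Below : Carrier → Subset Carrier
  Below a = record { member = λ x → x < a ; irrelevant = <-irrelevant }

  OpenInterval : Carrier → Carrier → Subset Carrier
  OpenInterval a b = record
    { member     = λ x → (a < x) × (x < b)
    ; irrelevant = irr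
    }
    where
    irr : Irrelevant (λ x → (a < x) × (x < b))
    irr (p , q) (p′ , q′) with refl ← <-irrelevant p p′ | refl ← <-irrelevant q q′ = refl

module _ {ℓ} (P : LinearOrder ℓ) (S : Subset (LinearOrder.Carrier P)) where
  open LinearOrder P

  private
    _<ₛ_ : Rel (Elements S) ℓ
    x <ₛ y = proj₁ x < proj₁ y

    compareₛ : Trichotomous _≡_ _<ₛ_
    compareₛ (x , p) (y , q) with compare x y
    ... | tri< x<y x≢y x≯y = tri< x<y (λ e → x≢y (cong proj₁ e)) x≯y
    ... | tri> x≮y x≢y x>y = tri> x≮y (λ e → x≢y (cong proj₁ e)) x>y
    ... | tri≈ x≮y refl x≯y with refl ← Subset.irrelevant S p q = tri≈ x≮y refl x≯y

  suborder : LinearOrder ℓ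
  suborder = record
    { Carrier            = Elements S
    ; _<_                = _<ₛ_
    ; isStrictTotalOrder = record
      { isStrictPartialOrder = record
        { isEquivalence = isEquivalence
        ; irrefl        = λ { refl → IsStrictTotalOrder.irrefl isStrictTotalOrder refl }
        ; trans         = trans
        ; <-resp-≈      = resp₂ _<ₛ_
        }
      ; compare = compareₛ
      }
    ; <-irrelevant = <-irrelevant
    }

-- An order type is given by any linear order that represents it; "P is of
-- type φ" is P ≅ φ.

infix 4 _≅_
_≅_ : ∀ {ℓ} → LinearOrder ℓ → LinearOrder ℓ → Set ℓ
P ≅ Q = ∃[ f ] IsOrderIsomorphism _≡_ _≡_ (LinearOrder._<_ P) (LinearOrder._<_ Q) f

-- A cardinal is an initial ordinal: a well-order that is not equinumerous
-- with any of its proper initial segments.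

record Cardinal ℓ : Set (suc ℓ) where
  field
    order : LinearOrder ℓ

  open LinearOrder order public

  field
    wellFounded : WellFounded _<_
    initial     : ∀ α → ¬ (Elements (Below α) ↔ Carrier)

∣_∣ : ∀ {ℓ} → Cardinal ℓ → Set ℓ
∣ κ ∣ = Cardinal.Carrier κ

Infinite : ∀ {ℓ} → Cardinal ℓ → Set ℓ
Infinite κ = ℕ ↣ ∣ κ ∣

-- The set of all functions from some ordinal α < μ to κ, whose cardinality
-- is κ^{<μ}.  The ordinal α < μ is the set of elements of μ below α.  The pair
-- records the domain, so functions with different domains are different.

infix 8 _^<_
_^<_ : ∀ {ℓ} → Cardinal ℓ → Cardinal ℓ → Set ℓ
κ ^< μ = Σ[ α ∈ ∣ μ ∣ ] (Elements (Cardinal.Below μ α) → ∣ κ ∣)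

Dense : ∀ {ℓ} → Cardinal ℓ → LinearOrder ℓ → Set ℓ
Dense κ P =
    (Σ[ a ∈ Carrier ] Σ[ b ∈ Carrier ] a ≢ b)
  × (∀ (a b : Carrier) → a < b → ∣ κ ∣ ↣ Elements (OpenInterval a b))
  where open LinearOrder P

Scattered : ∀ {ℓ} → Cardinal ℓ → LinearOrder ℓ → Set (suc ℓ)
Scattered κ P = ¬ (∃[ S ] Dense κ (suborder P S))

-- ψ ⟶[ φ ]¹⟨ ν ⨾ κ ⟩ is the relation ψ ⟶ [φ]¹_{ν,κ}.

_⟶[_]¹⟨_⨾_⟩ : ∀ {ℓ} → LinearOrder ℓ → LinearOrder ℓ → Cardinal ℓ → Cardinal ℓ → Set (suc ℓ)
_⟶[_]¹⟨_⨾_⟩ {ℓ} ψ φ ν κ =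
  (P : LinearOrder ℓ) → P ≅ ψ → (f : LinearOrder.Carrier P → ∣ ν ∣) →
  Σ[ A ∈ Subset ∣ ν ∣ ] Σ[ Q ∈ Subset (LinearOrder.Carrier P) ]
    (Elements A ↣ ∣ κ ∣)
    × (suborder P Q ≅ φ)
    × (∀ q → member Q q → member A (f q))

{-# OPTIONS --safe #-}

-- Fix an order U of size κ without κ-dense suborders in which every order of size < κ
-- embeds; it exists because κ^{<κ} = κ.  A well-founded tree whose nodes have well-ordered
-- sets of children becomes an order: a node is a point, with the sum of its U-indexed
-- copies of children to the right of it and the reversed sum to the left.  Such orders
-- have no κ-dense suborder.
--
-- Every κ-scattered φ embeds in such an order.  Call x and y equivalent if the interval
-- between them embeds.  Each class embeds, because it is a well-ordered sum of intervals on
-- either side of any of its points.  If there were two classes, a set of representatives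
-- would be κ-dense: fewer than κ classes between two given ones could be summed along U.
--
-- Given a tree s and ν, there is a tree t such that under every ν-colouring of t some copy
-- of s in t is coloured according to the sequence of U-labels (and sides) leading to a
-- point.  There are only κ such sequences.  The tree t is built by recursion on a game in
-- which an opponent reveals root colours while demanding, for each possible colour scheme,
-- the part of s at which a greedy embedding breaks off.

module Submission where

open import Defs
open import Axiom.ExcludedMiddle using (ExcludedMiddle)
open import Axiom.Extensionality.Propositional using (Extensionality)
open import Axiom.UniquenessOfIdentityProofs.WithK using (uip)
open import Data.Bool.Base using (Bool; true; false; T; if_then_else_)
open import Data.Bool.Properties using (T-irrelevant)
open import Data.Empty using (⊥; ⊥-elim)
open import Data.List.Base using (List; []; _∷_)
open import Data.Nat.Base using (ℕ; zero; suc)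
open import Data.Product using (Σ; Σ-syntax; _×_; _,_; proj₁; proj₂; map₂; swap)
open import Data.Sum.Base using (_⊎_; inj₁; inj₂; [_,_]′)
open import Data.Unit.Base using (⊤; tt)
open import Function.Base using (_∘_; _∋_; id; const)
open import Function.Bundles using (_↔_; _↣_; mk↣; module Injection)
open import Function.Properties.Inverse using (↔⇒↣)
open import Induction.WellFounded using (WellFounded; Acc; acc; module All; module FixPoint)
open import Level using (Level; Lift; lift; lower) renaming (suc to lsuc)
open import Relation.Binary.Core using (Rel)
open import Relation.Binary.Definitions using (Trichotomous; Transitive; Tri; tri<; tri≈; tri>)
  renaming (Irrelevant to Irrelevant₂)
open import Relation.Binary.Construct.Flip.EqAndOrd as Flip using ()
open import Relation.Binary.Morphism.Structures using (IsOrderIsomorphism)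
open import Relation.Binary.PropositionalEquality
  using (_≡_; _≢_; refl; sym; trans; cong; cong₂; cong-app; subst; subst₂; isEquivalence)
open import Relation.Binary.Structures using (IsStrictTotalOrder)
open import Relation.Binary.Structures.Biased using (isStrictTotalOrderᶜ)
open import Relation.Nullary using (¬_; Dec; yes; no)
open import Relation.Nullary.Decidable using (isYes; True; toWitness; fromWitness; decidable-stable)
open import Relation.Unary using (Pred)

open LinearOrder using (Carrier)

private
  variable
    ℓ p : Level

-- Linear orders, embeddings and lexicographic sums.

infix 4 _⊢_<_ _⊢_≤_ _↪_

_⊢_<_ _⊢_≤_ : (P : LinearOrder ℓ) → Rel (Carrier P) ℓ
P ⊢ x < y = LinearOrder._<_ P x y
P ⊢ x ≤ y = ¬ P ⊢ y < x

IsWellOrder : LinearOrder ℓ → Set ℓ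
IsWellOrder P = WellFounded (P ⊢_<_)

linearOrder : {A : Set ℓ} (_<_ : Rel A ℓ) → Transitive _<_ → Trichotomous _≡_ _<_ →
              Irrelevant₂ _<_ → LinearOrder ℓ
linearOrder _<_ tr cmp irr = record
  { isStrictTotalOrder = isStrictTotalOrderᶜ (record
    { isEquivalence = isEquivalence ; trans = tr ; compare = cmp })
  ; <-irrelevant = irr
  }

module _ (P : LinearOrder ℓ) where
  open LinearOrder P using (compare) renaming (trans to <-trans)

  <-irrefl : ∀ {x} → P ⊢ x ≤ x
  <-irrefl = IsStrictTotalOrder.irrefl (LinearOrder.isStrictTotalOrder P) refl

  <⇒≤ : ∀ {x y} → P ⊢ x < y → P ⊢ x ≤ y
  <⇒≤ x<y y<x = <-irrefl (<-trans x<y y<x)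

  ≤-<-trans : ∀ {x y z} → P ⊢ x ≤ y → P ⊢ y < z → P ⊢ x < z
  ≤-<-trans {x} {y} x≤y y<z with compare x y
  ... | tri< x<y _ _    = <-trans x<y y<z
  ... | tri≈ _ refl _   = y<z
  ... | tri> _ _ y<x    = ⊥-elim (x≤y y<x)

  ≤-trans : ∀ {x y z} → P ⊢ x ≤ y → P ⊢ y ≤ z → P ⊢ x ≤ z
  ≤-trans x≤y y≤z z<x = x≤y (≤-<-trans y≤z z<x)

  ≤⇒<⊎≡ : ∀ {x y} → P ⊢ x ≤ y → P ⊢ x < y ⊎ x ≡ y
  ≤⇒<⊎≡ {x} {y} x≤y with compare x y
  ... | tri< x<y _ _ = inj₁ x<y
  ... | tri≈ _ e _   = inj₂ e
  ... | tri> _ _ y<x = ⊥-elim (x≤y y<x)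

  ≤∧≢⇒< : ∀ {x y} → P ⊢ x ≤ y → x ≢ y → P ⊢ x < y
  ≤∧≢⇒< x≤y x≢y = [ id , ⊥-elim ∘ x≢y ]′ (≤⇒<⊎≡ x≤y)

  ≤-antisym : ∀ {x y} → P ⊢ x ≤ y → P ⊢ y ≤ x → x ≡ y
  ≤-antisym x≤y y≤x = [ ⊥-elim ∘ y≤x , id ]′ (≤⇒<⊎≡ x≤y)

_↪_ : LinearOrder ℓ → LinearOrder ℓ → Set ℓ
P ↪ Q = Σ[ f ∈ (Carrier P → Carrier Q) ] (∀ {x y} → P ⊢ x < y → Q ⊢ f x < f y)

module _ (P Q : LinearOrder ℓ) where
  open LinearOrder P using (compare)

  ↪-injective : ((f , _) : P ↪ Q) → ∀ {x y} → f x ≡ f y → x ≡ y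
  ↪-injective (f , f-mono) {x} {y} e with compare x y
  ... | tri< x<y _ _ = ⊥-elim (<-irrefl Q (subst (Q ⊢ f x <_) (sym e) (f-mono x<y)))
  ... | tri≈ _ x≡y _ = x≡y
  ... | tri> _ _ y<x = ⊥-elim (<-irrefl Q (subst (Q ⊢_< f x) (sym e) (f-mono y<x)))

  ↪-reflects-< : ((f , _) : P ↪ Q) → ∀ {x y} → Q ⊢ f x < f y → P ⊢ x < y
  ↪-reflects-< (f , f-mono) {x} {y} fx<fy with compare x y
  ... | tri< x<y _ _  = x<y
  ... | tri≈ _ refl _ = ⊥-elim (<-irrefl Q fx<fy)
  ... | tri> _ _ y<x  = ⊥-elim (<⇒≤ Q fx<fy (f-mono y<x))

  -- Embeddings are injective, so preimages are unique and membership needs no truncation.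
  image : P ↪ Q → Subset (Carrier Q)
  image e@(f , _) = record
    { member     = λ y → Σ[ x ∈ Carrier P ] f x ≡ y
    ; irrelevant = λ { (x , refl) (x′ , e′) → irr x x′ e′ }
    }
    where
    irr : ∀ x x′ (e′ : f x′ ≡ f x) → (x , refl) ≡ (Σ[ z ∈ Carrier P ] f z ≡ f x ∋ (x′ , e′))
    irr x x′ e′ with refl ← ↪-injective e e′ with refl ← e′ = refl

  image-≅ : (e : P ↪ Q) → suborder Q (image e) ≅ P
  image-≅ e@(f , f-mono) = proj₁ ∘ proj₂ , record
    { isOrderMonomorphism = record
      { isOrderHomomorphism = record
        { cong = cong (proj₁ ∘ proj₂)
        ; mono = λ { {_ , _ , refl} {_ , _ , refl} → ↪-reflects-< e }
        }
      ; injective = λ { {_ , _ , refl} {_ , _ , refl} refl → refl }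
      ; cancel    = λ { {_ , _ , refl} {_ , _ , refl} → f-mono }
      }
    ; surjective = λ x → (f x , x , refl) , λ { refl → refl }
    }

↪-trans : (P Q R : LinearOrder ℓ) → P ↪ Q → Q ↪ R → P ↪ R
↪-trans _ _ _ (f , f-mono) (g , g-mono) = g ∘ f , g-mono ∘ f-mono

≅⇒↪ : (P Q : LinearOrder ℓ) → P ≅ Q → Q ↪ P
≅⇒↪ _ Q (f , iso) = (λ y → proj₁ (surjective y)) , λ {x} {y} x<y →
  cancel (subst₂ (Q ⊢_<_) (sym (proj₂ (surjective x) refl)) (sym (proj₂ (surjective y) refl)) x<y)
  where open IsOrderIsomorphism iso using (surjective; cancel)

T-injective : ∀ {s t} → (T s → T t) → (T t → T s) → s ≡ t
T-injective {true}  {true}  _ _ = refl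
T-injective {true}  {false} f _ = ⊥-elim (f tt)
T-injective {false} {true}  _ g = ⊥-elim (g tt)
T-injective {false} {false} _ _ = refl

element-≡ : {A : Set ℓ} (S : Subset A) {x y : Elements S} → proj₁ x ≡ proj₁ y → x ≡ y
element-≡ S {x , p} {.x , q} refl = cong (x ,_) (Subset.irrelevant S p q)

reverse : LinearOrder ℓ → LinearOrder ℓ
reverse P = record
  { isStrictTotalOrder = Flip.isStrictTotalOrder (LinearOrder.isStrictTotalOrder P)
  ; <-irrelevant       = LinearOrder.<-irrelevant P
  }

Zero One : LinearOrder ℓ
Zero {ℓ} = linearOrder {A = Lift ℓ ⊥} (λ _ _ → Lift ℓ ⊥) (λ ()) (λ ()) (λ ())
One {ℓ} = linearOrder {A = Lift ℓ ⊤} (λ _ _ → Lift ℓ ⊥) (λ ()) (λ _ _ → tri≈ lower refl lower) (λ ())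

data Three {ℓ} : Set ℓ where
  lo mid hi : Three

data _<₃_ {ℓ} : Rel (Three {ℓ}) ℓ where
  lo<mid : lo <₃ mid
  lo<hi  : lo <₃ hi
  mid<hi : mid <₃ hi

Three-order : LinearOrder ℓ
Three-order = linearOrder _<₃_ tr cmp irr
  where
  tr : Transitive _<₃_
  tr lo<mid mid<hi = lo<hi

  cmp : Trichotomous _≡_ _<₃_
  cmp lo  lo  = tri≈ (λ ()) refl (λ ())
  cmp lo  mid = tri< lo<mid (λ ()) (λ ())
  cmp lo  hi  = tri< lo<hi (λ ()) (λ ())
  cmp mid lo  = tri> (λ ()) (λ ()) lo<mid
  cmp mid mid = tri≈ (λ ()) refl (λ ())
  cmp mid hi  = tri< mid<hi (λ ()) (λ ())
  cmp hi  lo  = tri> (λ ()) (λ ()) lo<hi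
  cmp hi  mid = tri> (λ ()) (λ ()) mid<hi
  cmp hi  hi  = tri≈ (λ ()) refl (λ ())

  irr : Irrelevant₂ _<₃_
  irr lo<mid lo<mid = refl
  irr lo<hi  lo<hi  = refl
  irr mid<hi mid<hi = refl

Zero-isWellOrder : IsWellOrder (Zero {ℓ})
Zero-isWellOrder ()

One-isWellOrder : IsWellOrder (One {ℓ})
One-isWellOrder _ = acc λ ()

Three-isWellOrder : IsWellOrder (Three-order {ℓ})
Three-isWellOrder = λ { lo → acc-lo ; mid → acc-mid ; hi → acc λ { lo<hi → acc-lo ; mid<hi → acc-mid } }
  where
  acc-lo : Acc _<₃_ lo
  acc-lo = acc λ ()
  acc-mid : Acc _<₃_ mid
  acc-mid = acc λ { lo<mid → acc-lo }

module _ (I : LinearOrder ℓ) (P : Carrier I → LinearOrder ℓ) where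

  data LexLess : Rel (Σ[ i ∈ Carrier I ] Carrier (P i)) ℓ where
    outer : ∀ {i j x y} → I ⊢ i < j → LexLess (i , x) (j , y)
    inner : ∀ {i x y} → P i ⊢ x < y → LexLess (i , x) (i , y)

  lex : LinearOrder ℓ
  lex = linearOrder LexLess tr cmp irr
    where
    tr : Transitive LexLess
    tr (outer a) (outer b) = outer (LinearOrder.trans I a b)
    tr (outer a) (inner _) = outer a
    tr (inner _) (outer b) = outer b
    tr (inner {i} a) (inner b) = inner (LinearOrder.trans (P i) a b)

    irr : Irrelevant₂ LexLess
    irr (outer a) (outer b) = cong outer (LinearOrder.<-irrelevant I a b)
    irr (outer a) (inner _) = ⊥-elim (<-irrefl I a)
    irr (inner _) (outer b) = ⊥-elim (<-irrefl I b)
    irr (inner {i} a) (inner b) = cong inner (LinearOrder.<-irrelevant (P i) a b)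

    irreflexive : ∀ {x} → ¬ LexLess x x
    irreflexive (outer a)     = <-irrefl I a
    irreflexive (inner {i} a) = <-irrefl (P i) a

    less : ∀ {x y} → LexLess x y → x ≢ y × ¬ LexLess y x
    less x<y = (λ { refl → irreflexive x<y }) , λ y<x → irreflexive (tr x<y y<x)

    cmp : Trichotomous _≡_ LexLess
    cmp (i , x) (j , y) with LinearOrder.compare I i j
    ... | tri< a _ _ = let ne , gt = less (outer a) in tri< (outer a) ne gt
    ... | tri> _ _ b = let ne , gt = less (outer b) in tri> gt (ne ∘ sym) (outer b)
    ... | tri≈ _ refl _ with LinearOrder.compare (P i) x y
    ...   | tri< a _ _    = let ne , gt = less (inner a) in tri< (inner a) ne gt
    ...   | tri> _ _ b    = let ne , gt = less (inner b) in tri> gt (ne ∘ sym) (inner b)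
    ...   | tri≈ _ refl _ = tri≈ irreflexive refl irreflexive

  lex-≤ : ∀ {u v} → LexLess u v → I ⊢ proj₁ u ≤ proj₁ v
  lex-≤ (outer a) = <⇒≤ I a
  lex-≤ (inner _) = <-irrefl I

-- Orders without κ-dense suborders

module _ (κ : Cardinal ℓ) where

  -- Quantifying over embedded orders instead of subsets makes the property easy to pass through
  -- sums; inclusions give back `Scattered`.
  DenseFree : LinearOrder ℓ → Set (lsuc ℓ)
  DenseFree P = ∀ Q → Dense κ Q → ¬ (Q ↪ P)

  through : {A B : Set ℓ} (S : Subset A) (f : Elements S → B) →
            (∀ x y → f x ≡ f y → proj₁ x ≡ proj₁ y) → ∣ κ ∣ ↣ Elements S → ∣ κ ∣ ↣ B
  through S f f-inj g = mk↣ {to = f ∘ Injection.to g} λ e →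
    Injection.injective g (element-≡ S (f-inj _ _ e))

  DenseFree⇒Scattered : ∀ P → DenseFree P → Scattered κ P
  DenseFree⇒Scattered P free (S , dense) = free (suborder P S) dense (proj₁ , id)

  DenseFree-reverse : ∀ P → DenseFree P → DenseFree (reverse P)
  DenseFree-reverse _ free Q ((a , b , a≢b) , intervals) (f , f-mono) = free (reverse Q)
    ((a , b , a≢b) , λ x y y<x → through (LinearOrder.OpenInterval Q y x) (map₂ swap) (λ _ _ → cong proj₁) (intervals y x y<x))
    (f , f-mono)

  -- A single interval of a κ-dense order already injects κ into `P`.
  DenseFree-small : ∀ P → ¬ (∣ κ ∣ ↣ Carrier P) → DenseFree P
  DenseFree-small P small Q ((a , b , a≢b) , intervals) e@(f , _)
    with LinearOrder.compare Q a b
  ... | tri≈ _ a≡b _ = a≢b a≡b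
  ... | tri< a<b _ _ = small (through (LinearOrder.OpenInterval Q a b) (f ∘ proj₁) (λ _ _ → ↪-injective Q P e) (intervals a b a<b))
  ... | tri> _ _ b<a = small (through (LinearOrder.OpenInterval Q b a) (f ∘ proj₁) (λ _ _ → ↪-injective Q P e) (intervals b a b<a))

  -- The element of κ makes every interval of `Q` inhabited. Replacing the right endpoint by an
  -- inner point again and again would give a descending sequence in `P`.
  DenseFree-wellOrder : ∣ κ ∣ → ∀ P → IsWellOrder P → DenseFree P
  DenseFree-wellOrder k P wf Q ((a , b , a≢b) , intervals) (f , f-mono) = nontrivial
    where
    minimal : ∀ {x y} → Acc (P ⊢_<_) (f y) → ¬ Q ⊢ x < y
    minimal (acc rec) x<y =
      let z , x<z , z<y = Injection.to (intervals _ _ x<y) k in minimal (rec (f-mono z<y)) x<z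

    nontrivial : ⊥
    nontrivial with LinearOrder.compare Q a b
    ... | tri< a<b _ _ = minimal (wf _) a<b
    ... | tri≈ _ a≡b _ = a≢b a≡b
    ... | tri> _ _ b<a = minimal (wf _) b<a

-- Classical tools: truncation, greedy recursion, well-orderings.

module _ (em : ∀ {a} → ExcludedMiddle a) (ext : ∀ {a b} → Extensionality a b) where

  stable : {A : Set p} → ¬ ¬ A → A
  stable = decidable-stable em

  -- Besides truncating A, this moves it to any universe level.
  ∥_∥ : Set p → Set ℓ
  ∥_∥ {ℓ = ℓ} A = Lift ℓ (True (em {P = A}))

  ∣_∣₁ : {A : Set p} → A → ∥_∥ {ℓ = ℓ} A
  ∣ a ∣₁ = lift (fromWitness a)

  choose : {A : Set p} → ∥_∥ {ℓ = ℓ} A → A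
  choose (lift t) = toWitness t

  ∥∥-irrelevant : {A : Set p} (s t : ∥_∥ {ℓ = ℓ} A) → s ≡ t
  ∥∥-irrelevant (lift s) (lift t) = cong lift (T-irrelevant s t)

  module _ (P : LinearOrder ℓ) (wf : IsWellOrder P) where

    least : (Q : Pred (Carrier P) p) → Σ _ Q → Σ[ x ∈ Carrier P ] Q x × (∀ {y} → Q y → P ⊢ x ≤ y)
    least Q (x , qx) = go x (wf x) qx
      where
      go : ∀ x → Acc (P ⊢_<_) x → Q x → Σ[ x ∈ Carrier P ] Q x × (∀ {y} → Q y → P ⊢ x ≤ y)
      go x (acc rec) qx with em {P = Σ[ y ∈ Carrier P ] P ⊢ y < x × Q y}
      ... | yes (y , y<x , qy) = go y (rec y<x) qy
      ... | no none            = x , qx , λ qy y<x → none (_ , y<x , qy)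

    -- If every partial assignment can be extended, recursion yields a total one; otherwise some
    -- assignment is stuck. The stuck assignment is not claimed to satisfy `G` at earlier points.
    greedy : {V : Set ℓ} (G : ∀ w → (∀ u → P ⊢ u < w → V) → V → Set p) →
             (Σ[ h ∈ (Carrier P → V) ] ∀ w → G w (λ u _ → h u) (h w)) ⊎
             (Σ[ w ∈ Carrier P ] Σ[ h ∈ (∀ u → P ⊢ u < w → V) ] ∀ v → ¬ G w h v)
    greedy {V = V} G
      with em {P = Σ[ w ∈ Carrier P ] Σ[ h ∈ (∀ u → P ⊢ u < w → V) ] ∀ v → ¬ G w h v}
    ... | yes stuck = inj₂ stuck
    ... | no ¬stuck = inj₁ (h , λ w → subst (G w _) (sym unfold-wfRec) (proj₂ (extend w _)))
      where
      extend : ∀ w h → Σ V (G w h)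
      extend w h = stable λ none → ¬stuck (w , h , λ v g → none (v , g))

      next : ∀ w → (∀ {u} → P ⊢ u < w → V) → V
      next w rec = proj₁ (extend w (λ u u<w → rec u<w))

      open FixPoint wf (const V) next (λ w same →
        cong (proj₁ ∘ extend w) (ext λ u → ext λ u<w → same u<w))

      h : Carrier P → V
      h = All.wfRec wf _ (const V) next

  -- If no two points of `Q` share a summand, `Q` embeds in `I`. Otherwise the fibre over a shared
  -- summand is convex, hence keeps its intervals and is itself κ-dense.
  DenseFree-lex : (κ : Cardinal ℓ) (I : LinearOrder ℓ) (P : Carrier I → LinearOrder ℓ) →
                  DenseFree κ I → (∀ i → DenseFree κ (P i)) → DenseFree κ (lex I P)
  DenseFree-lex κ I P I-free P-free Q dense@(_ , intervals) e@(f , f-mono)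
    with em {P = Σ[ x ∈ Carrier Q ] Σ[ y ∈ Carrier Q ] Q ⊢ x < y × proj₁ (f x) ≡ proj₁ (f y)}
  ... | no ¬same = I-free Q dense (proj₁ ∘ f , λ x<y → strict (f-mono x<y) λ eq → ¬same (_ , _ , x<y , eq))
    where
    strict : ∀ {u v} → lex I P ⊢ u < v → proj₁ u ≢ proj₁ v → I ⊢ proj₁ u < proj₁ v
    strict (outer a) _ = a
    strict (inner _) ≢ = ⊥-elim (≢ refl)
  ... | yes (a , b , a<b , same) = P-free i (suborder Q fibre) fibre-dense
      ( (λ { (x , q) → subst (Carrier ∘ P) q (proj₂ (f x)) })
      , λ { {x , q} {y , r} x<y → inFibre q r (f-mono x<y) })
    where
    i = proj₁ (f b)

    fibre : Subset (Carrier Q)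
    fibre = record { member = λ x → proj₁ (f x) ≡ i ; irrelevant = uip }

    inFibre : ∀ {u v} (q : proj₁ u ≡ i) (r : proj₁ v ≡ i) → lex I P ⊢ u < v →
              P i ⊢ subst (Carrier ∘ P) q (proj₂ u) < subst (Carrier ∘ P) r (proj₂ v)
    inFibre refl refl (outer a) = ⊥-elim (<-irrefl I a)
    inFibre refl refl (inner a) = a

    convex : ∀ {x y z} → proj₁ (f x) ≡ i → proj₁ (f y) ≡ i → Q ⊢ x < z → Q ⊢ z < y → proj₁ (f z) ≡ i
    convex {z = z} q r x<z z<y =
      ≤-antisym I (subst (I ⊢ proj₁ (f z) ≤_) r (lex-≤ I P (f-mono z<y)))
                  (subst (I ⊢_≤ proj₁ (f z)) q (lex-≤ I P (f-mono x<z)))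

    fibre-dense : Dense κ (suborder Q fibre)
    fibre-dense = ((a , same) , (b , refl) , λ { refl → <-irrefl Q a<b }) ,
      λ { (x , q) (y , r) x<y → through κ (LinearOrder.OpenInterval Q x y)
          (λ { (z , x<z , z<y) → (z , convex q r x<z z<y) , x<z , z<y })
          (λ _ _ → cong (proj₁ ∘ proj₁)) (intervals x y x<y) }

  -- Every well-founded relation extends to a well-order.  Starting from ∅, keep adding
  -- an element all of whose predecessors are present, and take unions; the stages of
  -- this process form a chain, and a precedes b when a belongs to the largest stage
  -- that omits b.
  module WellOrdering {A : Set ℓ} (_⊏_ : Rel A ℓ) (⊏-wf : WellFounded _⊏_) where

    infix 4 _∈_ _⊆_ _≺_

    _∈_ : A → (A → Bool) → Set
    a ∈ X = T (X a)

    record _⊆_ (X Y : A → Bool) : Set ℓ where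
      constructor ⊆-intro
      field ⊆-elim : ∀ {a} → a ∈ X → a ∈ Y
    open _⊆_

    ⊆-refl : ∀ {X} → X ⊆ X
    ⊆-refl = ⊆-intro id

    ⊆-trans : ∀ {X Y Z} → X ⊆ Y → Y ⊆ Z → X ⊆ Z
    ⊆-trans X⊆Y Y⊆Z = ⊆-intro (⊆-elim Y⊆Z ∘ ⊆-elim X⊆Y)

    ⟨_⟩ : Pred A p → (A → Bool)
    ⟨ P ⟩ a = isYes (em {P = P a})

    New : (A → Bool) → A → Set ℓ
    New X a = ¬ a ∈ X × (∀ b → b ⊏ a → b ∈ X)

    -- The new element is the one returned by `em`, so it is determined by `X`. The decision is an
    -- argument so that proofs can match on it.
    IsNext : (X : A → Bool) → Dec (Σ A (New X)) → A → Set ℓ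
    IsNext X (yes (b , _)) a = a ≡ b
    IsNext X (no _)        a = Lift _ ⊥

    next : (A → Bool) → (A → Bool)
    next X = ⟨ (λ a → a ∈ X ⊎ IsNext X em a) ⟩

    ⋃ : ((A → Bool) → Bool) → (A → Bool)
    ⋃ 𝒳 = ⟨ (λ a → Σ[ X ∈ (A → Bool) ] T (𝒳 X) × a ∈ X) ⟩

    -- The empty stage is the union of the empty family. Boolean-valued families keep the type in
    -- `Set ℓ`.
    data Stage : (A → Bool) → Set ℓ where
      step  : ∀ {X} → Stage X → Stage (next X)
      union : ∀ 𝒳 → (∀ X → T (𝒳 X) → Stage X) → Stage (⋃ 𝒳)

    ⊆-next : ∀ {X} → X ⊆ next X
    ⊆-next = ⊆-intro λ a∈X → fromWitness (inj₁ a∈X)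

    ⊆-antisym : ∀ {X Y} → X ⊆ Y → Y ⊆ X → X ≡ Y
    ⊆-antisym X⊆Y Y⊆X = ext λ a → T-injective (⊆-elim X⊆Y) (⊆-elim Y⊆X)

    next-cong : ∀ {X Y} → X ⊆ Y → Y ⊆ X → next X ⊆ next Y
    next-cong {X} X⊆Y Y⊆X = subst (λ Z → next X ⊆ next Z) (⊆-antisym X⊆Y Y⊆X) ⊆-refl

    witness : ∀ {X Y} → ¬ X ⊆ Y → Σ[ a ∈ A ] a ∈ X × ¬ a ∈ Y
    witness X⊈Y = stable λ none → X⊈Y (⊆-intro λ a∈X → stable λ a∉Y → none (_ , a∈X , a∉Y))

    outside : {𝒳 : (A → Bool) → Bool} {Y : A → Bool} → ¬ ⋃ 𝒳 ⊆ Y → Σ[ X ∈ (A → Bool) ] T (𝒳 X) × ¬ X ⊆ Y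
    outside ⋃⊈Y = let a , a∈ , a∉Y = witness ⋃⊈Y ; X , X∈ , a∈X = toWitness a∈ in
      X , X∈ , λ X⊆Y → a∉Y (⊆-elim X⊆Y a∈X)

    ⊆-⋃ : ∀ {𝒳 X} → T (𝒳 X) → X ⊆ ⋃ 𝒳
    ⊆-⋃ X∈ = ⊆-intro λ a∈X → fromWitness (_ , X∈ , a∈X)

    -- Induction on the first stage. In the successor case an inner induction, `gap`, shows that no
    -- stage lies strictly between `X` and `next X`.
    linear : ∀ {X Y} → Stage X → Stage Y → X ⊆ Y ⊎ next Y ⊆ X
    linear {Y = Y} (union 𝒳 stages) SY with em {P = ⋃ 𝒳 ⊆ Y}
    ... | yes ⋃⊆Y = inj₁ ⋃⊆Y
    ... | no ⋃⊈Y with X , X∈ , X⊈Y ← outside ⋃⊈Y with linear (stages X X∈) SY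
    ...   | inj₁ X⊆Y  = ⊥-elim (X⊈Y X⊆Y)
    ...   | inj₂ nY⊆X = inj₂ (⊆-trans nY⊆X (⊆-⋃ X∈))
    linear {Y = Y} (step {X} SX) SY with linear SX SY
    ... | inj₂ nY⊆X = inj₂ (⊆-trans nY⊆X ⊆-next)
    ... | inj₁ X⊆Y  = [ inj₁ , (λ Y⊆X → inj₂ (next-cong Y⊆X X⊆Y)) ]′ (gap SY X⊆Y)
      where
      gap : ∀ {Y} → Stage Y → X ⊆ Y → next X ⊆ Y ⊎ Y ⊆ X
      gap (union 𝒴 stages) X⊆⋃ with em {P = ⋃ 𝒴 ⊆ X}
      ... | yes ⋃⊆X = inj₂ ⋃⊆X
      ... | no ⋃⊈X with W , W∈ , W⊈X ← outside ⋃⊈X with linear SX (stages W W∈)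
      ...   | inj₂ nW⊆X = ⊥-elim (W⊈X (⊆-trans ⊆-next nW⊆X))
      ...   | inj₁ X⊆W with gap (stages W W∈) X⊆W
      ...     | inj₁ nX⊆W = inj₁ (⊆-trans nX⊆W (⊆-⋃ W∈))
      ...     | inj₂ W⊆X  = ⊥-elim (W⊈X W⊆X)
      gap (step {W} SW) _ with linear SX SW
      ... | inj₂ nW⊆X = inj₂ nW⊆X
      ... | inj₁ X⊆W with gap SW X⊆W
      ...   | inj₁ nX⊆W = inj₁ (⊆-trans nX⊆W ⊆-next)
      ...   | inj₂ W⊆X  = inj₁ (next-cong X⊆W W⊆X)

    omits : A → (A → Bool) → Bool
    omits a X = isYes (em {P = Stage X × ¬ a ∈ X})

    before : A → (A → Bool)
    before a = ⋃ (omits a)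

    before-stage : ∀ a → Stage (before a)
    before-stage a = union (omits a) λ _ X∈ → proj₁ (toWitness X∈)

    ∉-before : ∀ {a} → ¬ a ∈ before a
    ∉-before a∈ = let X , X∈ , a∈X = toWitness a∈ in proj₂ (toWitness X∈) a∈X

    ⊆-before : ∀ {a X} → Stage X → ¬ a ∈ X → X ⊆ before a
    ⊆-before SX a∉X = ⊆-⋃ (fromWitness (SX , a∉X))

    added : ∀ {X a} → a ∈ next X → ¬ a ∈ X → Σ[ new ∈ New X a ] em {P = Σ A (New X)} ≡ yes (a , new)
    added {X} a∈nX a∉X with toWitness a∈nX
    ... | inj₁ a∈X = ⊥-elim (a∉X a∈X)
    ... | inj₂ a-next with em {P = Σ A (New X)}
    ...   | no _ = ⊥-elim (lower a-next)
    ...   | yes (_ , new) with refl ← a-next = new , refl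

    added-unique : ∀ {X Y a b} → X ≡ Y → a ∈ next X → ¬ a ∈ X → b ∈ next Y → ¬ b ∈ Y → a ≡ b
    added-unique refl a∈ a∉ b∈ b∉ with _ , p ← added a∈ a∉ | _ , q ← added b∈ b∉
      with refl ← trans (sym p) q = refl

    new-element : ∀ {X a} → ¬ a ∈ X → Σ A (New X)
    new-element {X} {a} a∉X = go a (⊏-wf a) a∉X
      where
      go : ∀ a → Acc _⊏_ a → ¬ a ∈ X → Σ A (New X)
      go a (acc rec) a∉X with em {P = Σ[ b ∈ A ] b ⊏ a × ¬ b ∈ X}
      ... | yes (b , b⊏a , b∉X) = go b (rec b⊏a) b∉X
      ... | no none = a , a∉X , λ b b⊏a → stable λ b∉X → none (b , b⊏a , b∉X)

    next-grows : ∀ {X a} → ¬ a ∈ X → ¬ next X ⊆ X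
    next-grows {X} a∉X nX⊆X = go em refl
      where
      go : (d : Dec (Σ A (New X))) → em ≡ d → ⊥
      go (no none)            _  = none (new-element a∉X)
      go (yes (b , b∉X , _)) eq =
        b∉X (⊆-elim nX⊆X (fromWitness (inj₂ (subst (λ d → IsNext X d b) (sym eq) refl))))

    -- Otherwise `next (before a)` is a stage omitting `a`, hence contained in `before a`, although
    -- `next` adds an element.
    ∈-next-before : ∀ a → a ∈ next (before a)
    ∈-next-before a = stable λ a∉ → next-grows ∉-before (⊆-before (step (before-stage a)) a∉)

    _≺_ : Rel A ℓ
    a ≺ b = Lift ℓ (a ∈ before b)

    ≺-trans : Transitive _≺_
    ≺-trans {a} {b} {c} (lift a∈b) (lift b∈c) with linear (before-stage c) (before-stage b)
    ... | inj₁ c⊆b  = ⊥-elim (∉-before (⊆-elim c⊆b b∈c))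
    ... | inj₂ nb⊆c = lift (⊆-elim nb⊆c (⊆-elim ⊆-next a∈b))

    -- If `before a` and `before b` agree, then `a` and `b` are both the single element that `next`
    -- adds to this stage.
    ≺-compare : Trichotomous _≡_ _≺_
    ≺-compare a b with linear (before-stage a) (before-stage b)
    ... | inj₂ nb⊆a = tri> (λ { (lift a∈b) → ∉-before (⊆-elim nb⊆a (⊆-elim ⊆-next a∈b)) })
                          (λ { refl → ∉-before b∈a }) (lift b∈a)
      where b∈a = ⊆-elim nb⊆a (∈-next-before b)
    ... | inj₁ a⊆b with linear (before-stage b) (before-stage a)
    ...   | inj₂ na⊆b = tri< (lift a∈b) (λ { refl → ∉-before a∈b })
                          (λ { (lift b∈a) → ∉-before (⊆-elim na⊆b (⊆-elim ⊆-next b∈a)) })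
      where a∈b = ⊆-elim na⊆b (∈-next-before a)
    ...   | inj₁ b⊆a = tri≈ (λ { (lift a∈b) → ∉-before (⊆-elim b⊆a a∈b) }) a≡b (λ { (lift b∈a) → ∉-before (⊆-elim a⊆b b∈a) })
      where
      a≡b = added-unique (⊆-antisym a⊆b b⊆a) (∈-next-before a) ∉-before (∈-next-before b) ∉-before

    ≺-order : LinearOrder ℓ
    ≺-order = linearOrder _≺_ ≺-trans ≺-compare λ { (lift s) (lift t) → cong lift (T-irrelevant s t) }

    -- Induction on a stage containing the element: the predecessors of any element of `next X` lie
    -- in `X`.
    ≺-wf : IsWellOrder ≺-order
    ≺-wf a = accessible (step (before-stage a)) (∈-next-before a)
      where
      accessible : ∀ {X} → Stage X → ∀ {a} → a ∈ X → Acc _≺_ a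
      accessible (union 𝒳 stages) a∈ =
        let X , X∈ , a∈X = toWitness a∈ in accessible (stages X X∈) a∈X
      accessible (step {X} SX) {a} a∈ with linear (before-stage a) SX
      ... | inj₁ a⊆X  = acc λ { (lift b∈a) → accessible SX (⊆-elim a⊆X b∈a) }
      ... | inj₂ nX⊆a = ⊥-elim (∉-before (⊆-elim nX⊆a a∈))

    ⊏⇒≺ : ∀ {a b} → a ⊏ b → a ≺ b
    ⊏⇒≺ {a} {b} a⊏b = lift (proj₂ (proj₁ (added (∈-next-before b) ∉-before)) a a⊏b)

  -- Trees of well-ordered sums

  module Trees (U : LinearOrder ℓ) where

    data Tree : Set (lsuc ℓ) where
      node : (W : LinearOrder ℓ) → IsWellOrder W → (Carrier W → Tree) → Tree

    Label : Set ℓ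
    Label = Bool × Carrier U

    Toward : Bool → (W : LinearOrder ℓ) → Rel (Carrier W) ℓ
    Toward true  W w w′ = W ⊢ w < w′
    Toward false W w w′ = W ⊢ w′ < w

    graft : (W : LinearOrder ℓ) → (Carrier W → LinearOrder ℓ) → Three {ℓ} → LinearOrder ℓ
    graft W P lo  = lex (reverse W) λ w → lex U λ _ → P w
    graft W P mid = One
    graft W P hi  = lex W λ w → lex U λ _ → P w

    -- The root of a tree is a point.  Every child contributes a copy of itself for each
    -- label: to the right of the root in the order of W, or to the left of it in the
    -- reverse order.
    ⟦_⟧ : Tree → LinearOrder ℓ
    join : (W : LinearOrder ℓ) → (Carrier W → Tree) → LinearOrder ℓ
    ⟦ node W _ c ⟧ = join W c
    join W c = lex Three-order (graft W λ w → ⟦ c w ⟧)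

    Branches : Tree → LinearOrder ℓ
    Branches (node W _ _) = W

    Branches-wf : ∀ t → IsWellOrder (Branches t)
    Branches-wf (node _ wf _) = wf

    child : ∀ t → Carrier (Branches t) → Tree
    child (node _ _ c) = c

    root : ∀ t → Carrier ⟦ t ⟧
    root (node _ _ _) = mid , _

    module _ {W : LinearOrder ℓ} (c : Carrier W → Tree) where

      down : Label → (w : Carrier W) → Carrier ⟦ c w ⟧ → Carrier (join W c)
      down (true  , u) w x = hi , w , u , x
      down (false , u) w x = lo , w , u , x

      down-branch : ∀ b {u u′ w w′ x x′} → Toward b W w w′ →
                    join W c ⊢ down (b , u) w x < down (b , u′) w′ x′
      down-branch true  w<w′ = inner (outer w<w′)
      down-branch false w<w′ = inner (outer w<w′)

      down-label : ∀ b {u u′ w x x′} → U ⊢ u < u′ →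
                   join W c ⊢ down (b , u) w x < down (b , u′) w x′
      down-label true  u<u′ = inner (inner (outer u<u′))
      down-label false u<u′ = inner (inner (outer u<u′))

      down-inner : ∀ b {u w x x′} → ⟦ c w ⟧ ⊢ x < x′ →
                   join W c ⊢ down (b , u) w x < down (b , u) w x′
      down-inner true  x<x′ = inner (inner (inner x<x′))
      down-inner false x<x′ = inner (inner (inner x<x′))

    ⟦⟧-DenseFree : (κ : Cardinal ℓ) → ∣ κ ∣ → DenseFree κ U → ∀ t → DenseFree κ ⟦ t ⟧
    ⟦⟧-DenseFree κ k U-free (node W wf c) =
      DenseFree-lex κ Three-order _ (DenseFree-wellOrder κ k Three-order Three-isWellOrder) λ
        { lo  → DenseFree-lex κ (reverse W) _ (DenseFree-reverse κ W (DenseFree-wellOrder κ k W wf)) limb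
        ; mid → DenseFree-wellOrder κ k One One-isWellOrder
        ; hi  → DenseFree-lex κ W _ (DenseFree-wellOrder κ k W wf) limb }
      where
      limb : ∀ w → DenseFree κ (lex U λ _ → ⟦ c w ⟧)
      limb w = DenseFree-lex κ U _ U-free λ _ → ⟦⟧-DenseFree κ k U-free (c w)

    -- Canonical colourings.  Reading off the labels along the way to a point turns a
    -- colouring in K of the points at depth n into one of the branches of depth n in
    -- Pow K n.

    Pow : Set ℓ → ℕ → Set ℓ
    Pow K zero    = K
    Pow K (suc n) = Pow (Label → K) n

    Palette : Set ℓ → Set ℓ
    Palette K = ∀ n → Pow K n

    _▹_ : {K : Set ℓ} → K → Palette (Label → K) → Palette K
    (k ▹ χ) zero    = k
    (k ▹ χ) (suc n) = χ n

    later : {K : Set ℓ} → Palette K → Palette (Label → K)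
    later χ n = χ (suc n)

    Colouring : Tree → Set ℓ → Set ℓ
    Colouring t K = Carrier ⟦ t ⟧ → K

    -- All labelled copies of a point of the child are recorded at once, as a function of the label.
    restrict : ∀ {W} {K : Set ℓ} (c : Carrier W → Tree) → (Carrier (join W c) → K) → ∀ w → Colouring (c w) (Label → K)
    restrict c F w x δ = F (down c δ w x)

    -- One palette `later χ` serves every child, so colours depend on labels and not on branches.
    -- One map per child serves all its labelled copies.
    Canonical : {K : Set ℓ} (s t : Tree) → Colouring t K → Palette K → Set ℓ
    Canonical (node W _ c) t@(node V _ d) F χ =
      (F (root t) ≡ χ 0) ×
      Σ[ h ∈ (Carrier W → Carrier V) ] (∀ {w w′} → W ⊢ w < w′ → V ⊢ h w < h w′) ×
        (∀ w → Canonical (c w) (d (h w)) (restrict d F (h w)) (later χ))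

    colour : {K : Set ℓ} → Palette K → List Label → K
    colour χ []       = χ 0
    colour χ (δ ∷ δs) = colour (later χ) δs δ

    address : ∀ t → Carrier ⟦ t ⟧ → List Label
    address (node _ _ c) (lo  , w , u , x) = (false , u) ∷ address (c w) x
    address (node _ _ c) (mid , _)         = []
    address (node _ _ c) (hi  , w , u , x) = (true , u) ∷ address (c w) x

    canonical-map : ∀ {K} s t {F : Colouring t K} {χ} → Canonical s t F χ → Carrier ⟦ s ⟧ → Carrier ⟦ t ⟧
    canonical-map (node _ _ c) (node _ _ d) (_ , h , _ , r) (lo  , w , u , x) =
      lo , h w , u , canonical-map (c w) (d (h w)) (r w) x
    canonical-map (node _ _ c) (node _ _ d) _ (mid , _) = mid , _
    canonical-map (node _ _ c) (node _ _ d) (_ , h , _ , r) (hi  , w , u , x) =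
      hi , h w , u , canonical-map (c w) (d (h w)) (r w) x

    canonical-mono : ∀ {K} s t {F : Colouring t K} {χ} (r : Canonical s t F χ) {x y} →
                     ⟦ s ⟧ ⊢ x < y → ⟦ t ⟧ ⊢ canonical-map s t r x < canonical-map s t r y
    canonical-mono (node _ _ _) (node _ _ _) _ (outer lo<mid) = outer lo<mid
    canonical-mono (node _ _ _) (node _ _ _) _ (outer lo<hi)  = outer lo<hi
    canonical-mono (node _ _ _) (node _ _ _) _ (outer mid<hi) = outer mid<hi
    canonical-mono (node _ _ _) (node _ _ _) (_ , _ , h-mono , _) (inner {lo} (outer a)) = inner (outer (h-mono a))
    canonical-mono (node _ _ _) (node _ _ _) _ (inner {lo} (inner (outer a))) = inner (inner (outer a))
    canonical-mono (node _ _ c) (node _ _ d) (_ , h , _ , r) (inner {lo} (inner {w} (inner a))) =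
      inner (inner (inner (canonical-mono (c w) (d (h w)) (r w) a)))
    canonical-mono (node _ _ _) (node _ _ _) _ (inner {mid} ())
    canonical-mono (node _ _ _) (node _ _ _) (_ , _ , h-mono , _) (inner {hi} (outer a)) = inner (outer (h-mono a))
    canonical-mono (node _ _ _) (node _ _ _) _ (inner {hi} (inner (outer a))) = inner (inner (outer a))
    canonical-mono (node _ _ c) (node _ _ d) (_ , h , _ , r) (inner {hi} (inner {w} (inner a))) =
      inner (inner (inner (canonical-mono (c w) (d (h w)) (r w) a)))

    canonical-colour : ∀ {K} s t {F : Colouring t K} {χ} (r : Canonical s t F χ) x →
                       F (canonical-map s t r x) ≡ colour χ (address s x)
    canonical-colour (node _ _ c) (node _ _ d) (_ , h , _ , r) (lo , w , u , x) =
      cong (λ g → g (false , u)) (canonical-colour (c w) (d (h w)) (r w) x)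
    canonical-colour (node _ _ c) (node _ _ d) (e , _) (mid , _) = e
    canonical-colour (node _ _ c) (node _ _ d) (_ , h , _ , r) (hi , w , u , x) =
      cong (λ g → g (true , u)) (canonical-colour (c w) (d (h w)) (r w) x)

    canonical-node : ∀ {K V wf d χ} s (F : Colouring (node V wf d) K) →
      (h : Carrier (Branches s) → Carrier V) → (∀ {w w′} → Branches s ⊢ w < w′ → V ⊢ h w < h w′) →
      (∀ w → Canonical (child s w) (d (h w)) (restrict d F (h w)) χ) →
      Canonical s (node V wf d) F (F (root (node V wf d)) ▹ χ)
    canonical-node (node _ _ _) F h h-mono r = refl , h , h-mono , r

    -- A demand assigns to each palette a tree that is to be found in the colouring of
    -- that palette.  If a colouring satisfies no part of a demand D, then, above all the
    -- points used by attempts to build D (k ▹ χ) branch by branch (k being the colour of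
    -- the root), it satisfies no part of the demand formed by the children w χ at
    -- which the attempts get stuck.
    Demand : Set ℓ → Set (lsuc ℓ)
    Demand K = Palette K → Tree

    Choice : {K : Set ℓ} → Demand K → K → Set ℓ
    Choice D k = ∀ χ → Carrier (Branches (D (k ▹ χ)))

    reduce : {K : Set ℓ} (D : Demand K) (k : K) → Choice D k → Demand (Label → K)
    reduce D k w χ = child (D (k ▹ χ)) (w χ)

    -- Accessibility in the game where the opponent plays a root colour and the stuck positions; `K`
    -- grows with each move.
    data Terminates : (K : Set ℓ) → Demand K → Set (lsuc ℓ) where
      terminates : ∀ {K D} → (∀ k w → Terminates (Label → K) (reduce D k w)) → Terminates K D

    -- An infinite run would choose a palette one colour at a time, and the trees demanded
    -- along that palette would form an infinite branch.
    allTerminate : ∀ {K} (D : Demand K) → Terminates K D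
    allTerminate D = stable λ ¬t → descend (D (palette (run D ¬t))) (run D ¬t) refl
      where
      record Run : Set (lsuc ℓ) where
        constructor run
        field
          {colours} : Set ℓ
          demand    : Demand colours
          infinite  : ¬ Terminates colours demand
      open Run

      move : ∀ r → Σ[ k ∈ colours r ] Σ[ w ∈ Choice (demand r) k ]
             ¬ Terminates (Label → colours r) (reduce (demand r) k w)
      move r = stable λ none → infinite r (terminates λ k w → stable λ ¬t → none (k , w , ¬t))

      successor : Run → Run
      successor r = let _ , _ , ¬t = move r in run _ ¬t

      palette : ∀ r → Palette (colours r)
      palette r zero    = proj₁ (move r)
      palette r (suc n) = palette (successor r) n

      unfold-palette : ∀ r → proj₁ (move r) ▹ palette (successor r) ≡ palette r
      unfold-palette r = ext λ { zero → refl ; (suc n) → refl }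

      descend : ∀ t r → demand r (palette r) ≡ t → ⊥
      descend (node W wf c) r eq =
        -- The demanded tree equals `node W wf c` only propositionally. Generalising over it lets
        -- the stuck branch be read as a branch of `W`.
        go (demand r (proj₁ (move r) ▹ palette (successor r)))
           (trans (cong (demand r) (unfold-palette r)) eq) (proj₁ (proj₂ (move r)) (palette (successor r))) refl
        where
        go : ∀ t → t ≡ node W wf c → ∀ w →
             demand (successor r) (palette (successor r)) ≡ child t w → ⊥
        go _ refl w eq′ = descend (c w) (successor r) eq′

    module _ {K : Set ℓ} (D : Demand K) where

      Attempts : Σ K (Choice D) → Set ℓ
      Attempts (k , w) =
        Σ[ χ ∈ Palette (Label → K) ] Σ[ u ∈ Carrier (Branches (D (k ▹ χ))) ] Branches (D (k ▹ χ)) ⊢ u < w χ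

      -- The branches at the root of the tree being built: an opponent's move together with a spine
      -- point for every position its attempts have passed. As a W-type it has a point above any
      -- such collection.
      data Spine : Set ℓ where
        sup : ∀ q → (Attempts q → Spine) → Spine

      data _⊏_ : Rel Spine ℓ where
        ⊏-sup : ∀ {q g} a → g a ⊏ sup q g

      ⊏-wf : WellFounded _⊏_
      ⊏-wf (sup q g) = acc λ { (⊏-sup a) → ⊏-wf (g a) }

    -- The child at `sup q _` realizes, by recursion, the demand left after move `q`. If `F`
    -- satisfied no part of `D`, the greedy embedding for each palette would get stuck, and these
    -- stuck positions form a move.
    realize : ∀ {K} (D : Demand K) → Terminates K D →
              Σ[ t ∈ Tree ] ∀ (F : Colouring t K) → Σ[ χ ∈ Palette K ] Canonical (D χ) t F χ
    realize {K} D (terminates next) = t , λ F → stable (unavoidable F)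
      where
      open WellOrdering (_⊏_ D) (⊏-wf D) using (_≺_; ≺-order; ≺-wf; ⊏⇒≺)

      realize-next : ∀ q → Σ[ t ∈ Tree ] ∀ (F : Colouring t (Label → K)) →
                     Σ[ χ ∈ Palette (Label → K) ] Canonical (reduce D (proj₁ q) (proj₂ q) χ) t F χ
      realize-next (k , w) = realize (reduce D k w) (next k w)

      d : Spine D → Tree
      d (sup q _) = proj₁ (realize-next q)

      t : Tree
      t = node ≺-order ≺-wf d

      unavoidable : (F : Colouring t K) → ¬ ¬ (Σ[ χ ∈ Palette K ] Canonical (D χ) t F χ)
      -- `v` lies above all points used by all attempts, and its child tree realizes the missing
      -- part for some `χ`; so the attempt for that `χ` was not stuck.
      unavoidable F none = let χ , r = proj₂ (realize-next (k , w)) (restrict d F v) in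
        proj₂ (proj₂ (stuck χ)) v ((λ u u<w → ⊏⇒≺ (⊏-sup (χ , u , u<w))) , r)
        where
        k : K
        k = F (root t)

        Extends : ∀ χ w → (∀ u → Branches (D (k ▹ χ)) ⊢ u < w → Spine D) → Spine D → Set ℓ
        Extends χ w h v = (∀ u u<w → h u u<w ≺ v) × Canonical (child (D (k ▹ χ)) w) (d v) (restrict {≺-order} d F v) χ

        stuck : ∀ χ → Σ[ w ∈ Carrier (Branches (D (k ▹ χ))) ]
                Σ[ h ∈ (∀ u → Branches (D (k ▹ χ)) ⊢ u < w → Spine D) ] ∀ v → ¬ Extends χ w h v
        stuck χ = [ (λ { (h , good) → ⊥-elim (none (k ▹ χ , satisfied h good)) }) , id ]′
                    (greedy (Branches (D (k ▹ χ))) (Branches-wf (D (k ▹ χ))) (Extends χ))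
          where
          satisfied : ∀ h → (∀ w → Extends χ w (λ u _ → h u) (h w)) → Canonical (D (k ▹ χ)) t F (k ▹ χ)
          satisfied h good = canonical-node (D (k ▹ χ)) F h (λ w<w′ → proj₁ (good _) _ w<w′) (proj₂ ∘ good)

        w : Choice D k
        w χ = proj₁ (stuck χ)

        v : Spine D
        v = sup (k , w) λ { (χ , u , u<w) → proj₁ (proj₂ (stuck χ)) u u<w }

  -- The universal small order

  module Coding (κ : Cardinal ℓ) (infinite : Infinite κ) (κ^<κ↔κ : (κ ^< κ) ↔ ∣ κ ∣) where
    open Cardinal κ using (Below; order; wellFounded; compare)

    Segment : ∣ κ ∣ → Set ℓ
    Segment α = Elements (Below α)

    pack : κ ^< κ → ∣ κ ∣
    pack = Injection.to (↔⇒↣ κ^<κ↔κ)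

    pack-injective : ∀ {s t} → pack s ≡ pack t → s ≡ t
    pack-injective = Injection.injective (↔⇒↣ κ^<κ↔κ)

    pack-injective₂ : ∀ {α f g} → pack (α , f) ≡ pack (α , g) → f ≡ g
    pack-injective₂ eq with refl ← pack-injective eq = refl

    TwoBelow : Set ℓ
    TwoBelow = Σ[ α ∈ ∣ κ ∣ ] Σ[ a ∈ Segment α ] Σ[ b ∈ Segment α ] proj₁ a ≢ proj₁ b

    -- The largest of three distinct elements of κ has the other two below it. They serve as binary
    -- digits and as positions in a pair.
    twoBelow : TwoBelow
    twoBelow = first
      where
      n : ℕ → ∣ κ ∣
      n = Injection.to infinite

      distinct : ∀ {i j} → i ≢ j → n i ≢ n j
      distinct i≢j = i≢j ∘ Injection.injective infinite

      third : ∀ {a b} → order ⊢ a < b → n 2 ≢ a → n 2 ≢ b → TwoBelow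
      third {a} {b} a<b 2≢a 2≢b with compare (n 2) b
      ... | tri< 2<b _ _ = b , (n 2 , 2<b) , (a , a<b) , 2≢a
      ... | tri≈ _ e _   = ⊥-elim (2≢b e)
      ... | tri> _ _ b<2 = n 2 , (a , LinearOrder.trans order a<b b<2) , (b , b<2) ,
                           λ { refl → <-irrefl order a<b }

      first : TwoBelow
      first with compare (n 0) (n 1)
      ... | tri< 0<1 _ _ = third 0<1 (distinct λ ()) (distinct λ ())
      ... | tri≈ _ e _   = ⊥-elim (distinct (λ ()) e)
      ... | tri> _ _ 1<0 = third 1<0 (distinct λ ()) (distinct λ ())

    β : ∣ κ ∣
    β = proj₁ twoBelow

    k₀ k₁ : Segment β
    k₀ = proj₁ (proj₂ twoBelow)
    k₁ = proj₁ (proj₂ (proj₂ twoBelow))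

    k₀≢k₁ : proj₁ k₀ ≢ proj₁ k₁
    k₀≢k₁ = proj₂ (proj₂ (proj₂ twoBelow))

    ifDec : {A : Set p} {B : Set ℓ} → Dec A → B → B → B
    ifDec d x y = if isYes d then x else y

    ifDec-yes : {A : Set p} {B : Set ℓ} (d : Dec A) {x y : B} → A → ifDec d x y ≡ x
    ifDec-yes (yes _) _ = refl
    ifDec-yes (no ¬a) a = ⊥-elim (¬a a)

    ifDec-no : {A : Set p} {B : Set ℓ} (d : Dec A) {x y : B} → ¬ A → ifDec d x y ≡ y
    ifDec-no (yes a) ¬a = ⊥-elim (¬a a)
    ifDec-no (no _)  _  = refl

    bit : Set p → ∣ κ ∣
    bit A = ifDec (em {P = A}) (proj₁ k₁) (proj₁ k₀)

    bit-transfer : {A B : Set p} → bit A ≡ bit B → A → B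
    bit-transfer {A = A} {B = B} eq a = stable λ ¬b → k₀≢k₁
      (trans (sym (ifDec-no em ¬b)) (trans (sym eq) (ifDec-yes em a)))

    pair : ∣ κ ∣ → ∣ κ ∣ → ∣ κ ∣
    pair a b = pack (β , λ x → ifDec (em {P = proj₁ x ≡ proj₁ k₀}) a b)

    pair-injective : ∀ {a b a′ b′} → pair a b ≡ pair a′ b′ → a ≡ a′ × b ≡ b′
    pair-injective eq = let same = cong-app (pack-injective₂ eq) in
      trans (sym (ifDec-yes em refl)) (trans (same k₀) (ifDec-yes em refl)) ,
      trans (sym (ifDec-no em (k₀≢k₁ ∘ sym))) (trans (same k₁) (ifDec-no em (k₀≢k₁ ∘ sym)))

    encodeList : {A : Set ℓ} → (A → ∣ κ ∣) → List A → ∣ κ ∣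
    encodeList f []       = pair (proj₁ k₀) (proj₁ k₀)
    encodeList f (x ∷ xs) = pair (proj₁ k₁) (pair (f x) (encodeList f xs))

    encodeList-injective : {A : Set ℓ} (f : A → ∣ κ ∣) → (∀ {x y} → f x ≡ f y → x ≡ y) →
                           ∀ xs ys → encodeList f xs ≡ encodeList f ys → xs ≡ ys
    encodeList-injective f f-inj []       []       _  = refl
    encodeList-injective f f-inj []       (_ ∷ _)  eq = ⊥-elim (k₀≢k₁ (proj₁ (pair-injective eq)))
    encodeList-injective f f-inj (_ ∷ _)  []       eq = ⊥-elim (k₀≢k₁ (sym (proj₁ (pair-injective eq))))
    encodeList-injective f f-inj (x ∷ xs) (y ∷ ys) eq
      with eq₁ , eq₂ ← pair-injective (proj₂ (pair-injective eq))
      with refl ← f-inj eq₁ | refl ← encodeList-injective f f-inj xs ys eq₂ = refl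

    -- Enumerate `A` along κ without repetition. Never getting stuck would inject κ into `A`, so at
    -- some `α` every element has been listed.
    small⇒segment : {A : Set ℓ} → ¬ (∣ κ ∣ ↣ A) →
                    Σ[ α ∈ ∣ κ ∣ ] Σ[ s ∈ (A → Segment α) ] (∀ {x y} → s x ≡ s y → x ≡ y)
    small⇒segment {A} small = [ (λ { (h , new) → ⊥-elim (small (mk↣ (injective h new))) }) , segment ]′
                              (greedy order wellFounded λ _ h x → ∀ u u<w → h u u<w ≢ x)
      where
      injective : (h : ∣ κ ∣ → A) → (∀ w u → order ⊢ u < w → h u ≢ h w) → ∀ {u w} → h u ≡ h w → u ≡ w
      injective h new {u} {w} e with compare u w
      ... | tri< u<w _ _ = ⊥-elim (new w u u<w e)
      ... | tri≈ _ u≡w _ = u≡w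
      ... | tri> _ _ w<u = ⊥-elim (new u w w<u (sym e))

      segment : (Σ[ α ∈ ∣ κ ∣ ] Σ[ h ∈ (∀ u → order ⊢ u < α → A) ] ∀ x → ¬ (∀ u u<α → h u u<α ≢ x)) →
                Σ[ α ∈ ∣ κ ∣ ] Σ[ s ∈ (A → Segment α) ] (∀ {x y} → s x ≡ s y → x ≡ y)
      segment (α , h , onto) = α , (λ x → let u , u<α , _ = preimage x in u , u<α) ,
        λ {x} {y} e → trans (sym (proj₂ (proj₂ (preimage x))))
                        (trans (cong (λ { (u , u<α) → h u u<α }) e) (proj₂ (proj₂ (preimage y))))
        where
        preimage : ∀ x → Σ[ u ∈ ∣ κ ∣ ] Σ[ u<α ∈ order ⊢ u < α ] h u u<α ≡ x
        preimage x = stable λ none → onto x λ u u<α e → none (u , u<α , e)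

    module _ (J : LinearOrder ℓ) {α : ∣ κ ∣} (s : Carrier J → Segment α) where

      -- With the reflexive order, the diagonal of the relation records which positions are in the
      -- range of `s`.
      Graph : Segment α → Segment α → Set ℓ
      Graph u v = Σ[ x ∈ Carrier J ] Σ[ y ∈ Carrier J ] s x ≡ u × s y ≡ v × J ⊢ x ≤ y

      code : ∣ κ ∣
      code = pack (α , λ u → pack (α , λ v → bit (Graph u v)))

    code-injective : ∀ J J′ {α} {s : Carrier J → Segment α} {s′ : Carrier J′ → Segment α} →
                     code J s ≡ code J′ s′ → ∀ {u v} → Graph J s u v → Graph J′ s′ u v
    code-injective _ _ eq {u} {v} = bit-transfer (cong-app (pack-injective₂ (cong-app (pack-injective₂ eq) u)) v)

    Decoding : ∣ κ ∣ → Set (lsuc ℓ)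
    Decoding l = Σ[ J ∈ LinearOrder ℓ ] DenseFree κ J × (Σ[ α ∈ ∣ κ ∣ ] Σ[ s ∈ (Carrier J → Segment α) ]
                 (∀ {x y} → s x ≡ s y → x ≡ y) × l ≡ code J s)

    -- Equal codes give the same `α` and the same relation on it, so points at equal positions
    -- correspond. Hence it does not matter which order `em` picks for a code.
    embed-decoding : ∀ {l} ((J , _) (J′ , _) : Decoding l) → J ↪ J′
    embed-decoding (J , _ , α , s , s-inj , refl) (J′ , _ , α′ , s′ , s′-inj , eq)
      with refl ← cong proj₁ (pack-injective eq) = f , λ {x} {y} → f-mono x y
      where
      match : ∀ x → Graph J′ s′ (s x) (s x)
      match x = code-injective J J′ eq (x , x , refl , refl , <-irrefl J)

      f : Carrier J → Carrier J′
      f x = proj₁ (match x)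

      s′f : ∀ x → s′ (f x) ≡ s x
      s′f x = proj₁ (proj₂ (proj₂ (match x)))

      f-mono : ∀ x y → J ⊢ x < y → J′ ⊢ f x < f y
      f-mono x y x<y =
        let _ , _ , ex , ey , x′≤y′ = code-injective J J′ eq (x , y , refl , refl , <⇒≤ J x<y) in
        ≤∧≢⇒< J′
          (subst₂ (J′ ⊢_≤_) (s′-inj (trans ex (sym (s′f x)))) (s′-inj (trans ey (sym (s′f y)))) x′≤y′)
          λ e → <-irrefl J (subst (J ⊢_< y) (s-inj (trans (sym (s′f x)) (trans (cong s′ e) (s′f y)))) x<y)

    decode : ∀ {l} → Dec (Decoding l) → LinearOrder ℓ
    decode (yes (J , _)) = J
    decode (no _)        = Zero

    decode-DenseFree : ∀ {l} (d : Dec (Decoding l)) → DenseFree κ (decode d)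
    decode-DenseFree (yes (_ , free , _)) = free
    decode-DenseFree (no _) = DenseFree-wellOrder κ (proj₁ k₀) Zero Zero-isWellOrder

    decode-injection : ∀ {l} (d : Dec (Decoding l)) →
                       Σ[ ι ∈ (Carrier (decode d) → ∣ κ ∣) ] (∀ {x y} → ι x ≡ ι y → x ≡ y)
    decode-injection (yes (_ , _ , α , s , s-inj , _)) = proj₁ ∘ s , s-inj ∘ element-≡ (Below α)
    decode-injection (no _) = (λ ()) , λ {}

    embed-decode : ∀ {l} ((J , _) : Decoding l) (d : Dec (Decoding l)) → J ↪ decode d
    embed-decode J (yes J′) = embed-decoding J J′
    embed-decode J (no ¬J)  = ⊥-elim (¬J J)

    -- The sum of all orders of size < κ without κ-dense suborders; there are at most κ
    -- isomorphism types of them because κ^{<κ} = κ.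
    Universal : LinearOrder ℓ
    Universal = lex order λ l → decode (em {P = Decoding l})

    Universal-DenseFree : DenseFree κ Universal
    Universal-DenseFree = DenseFree-lex κ order _ (DenseFree-wellOrder κ (proj₁ k₀) order wellFounded)
                                        λ _ → decode-DenseFree em

    -- This bounds the number of labels, and so of label sequences, by κ.
    encodeUniversal : Carrier Universal → ∣ κ ∣
    encodeUniversal (l , x) = pair l (proj₁ (decode-injection em) x)

    encodeUniversal-injective : ∀ {u v} → encodeUniversal u ≡ encodeUniversal v → u ≡ v
    encodeUniversal-injective {l , x} {_ , y} eq with pair-injective eq
    ... | refl , eq′ = cong (l ,_) (proj₂ (decode-injection em) eq′)

    small⇒↪Universal : ∀ J → ¬ (∣ κ ∣ ↣ Carrier J) → J ↪ Universal
    small⇒↪Universal J small =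
      let α , s , s-inj = small⇒segment small
          f , f-mono = embed-decode (J , DenseFree-small κ J small , α , s , (λ {_} {_} → s-inj) , refl) em
      in (λ x → code J s , f x) , λ x<y → inner (f-mono x<y)

  -- Scattered orders embed into trees

  module Hausdorff (U : LinearOrder ℓ) (u₀ : Carrier U) (φ : LinearOrder ℓ) where
    open Trees U
    open LinearOrder φ using (compare) renaming (Carrier to C)

    -- Embeddability of `S` in a tree order. Taking membership proofs as arguments allows predicates
    -- of any level, such as `x ~_`.
    Good : Pred C p → Set _
    Good S = Σ[ t ∈ Tree ] Σ[ e ∈ (∀ x → S x → Carrier ⟦ t ⟧) ]
             (∀ {x y} (sx : S x) (sy : S y) → φ ⊢ x < y → ⟦ t ⟧ ⊢ e x sx < e y sy)

    Good-⊆ : ∀ {q} {S : Pred C p} {S′ : Pred C q} → (∀ {x} → S x → S′ x) → Good S′ → Good S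
    Good-⊆ S⊆S′ (t , e , e-mono) = t , (λ x sx → e x (S⊆S′ sx)) , λ sx sy → e-mono _ _

    -- By linearity such a set has at most one point, so a leaf suffices.
    Good-antichain : {S : Pred C p} → (∀ {x y} → S x → S y → ¬ φ ⊢ x < y) → Good S
    Good-antichain ¬< = leaf , (λ _ _ → root leaf) , λ sx sy x<y → ⊥-elim (¬< sx sy x<y)
      where
      leaf : Tree
      leaf = node Zero Zero-isWellOrder λ ()

    Good-inhabited : {S : Pred C p} → (∀ {x} → S x → Good S) → Good S
    Good-inhabited {S = S} good with em {P = Σ C S}
    ... | yes (_ , sx) = good sx
    ... | no empty     = Good-antichain λ sx _ _ → empty (_ , sx)

    Toward-compare : ∀ b W → Trichotomous _≡_ (Toward b W)
    Toward-compare true  W = LinearOrder.compare W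
    Toward-compare false W = LinearOrder.compare (reverse W)

    -- Each fibre of `m` goes into its own child, in the copy labelled `u₀`; `b` chooses between the
    -- well-ordered sum and the reversed one.
    Good-sum : ∀ b {S : Pred C p} (W : LinearOrder ℓ) → IsWellOrder W → (m : ∀ x → S x → Carrier W) →
               (∀ {x y} sx sy → φ ⊢ x < y → ¬ Toward b W (m y sy) (m x sx)) →
               (∀ w → Good (λ x → Σ[ sx ∈ S x ] m x sx ≡ w)) → Good S
    Good-sum b {S} W wf m m-mono fibres = node W wf c , (λ x sx → down c (b , u₀) (m x sx) (e _ (sx , refl))) ,
      λ sx sy x<y → glue sx refl sy refl x<y (Toward-compare b W _ _)
      where
      c : Carrier W → Tree
      c w = proj₁ (fibres w)

      e : ∀ {w} x → (Σ[ sx ∈ S x ] m x sx ≡ w) → Carrier ⟦ c w ⟧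
      e {w} = proj₁ (proj₂ (fibres w))

      glue : ∀ {x y v w} (sx : S x) (p : m x sx ≡ v) (sy : S y) (q : m y sy ≡ w) → φ ⊢ x < y →
             Tri (Toward b W v w) (v ≡ w) (Toward b W w v) →
             join W c ⊢ down c (b , u₀) v (e x (sx , p)) < down c (b , u₀) w (e y (sy , q))
      glue _  _    _  _    _   (tri< v<w _ _)  = down-branch c b v<w
      glue sx p    sy q    x<y (tri≈ _ refl _) = down-inner c b (proj₂ (proj₂ (fibres _)) (sx , p) (sy , q) x<y)
      glue sx refl sy refl x<y (tri> _ _ w<v)  = ⊥-elim (m-mono sx sy x<y w<v)

    Good-⊎ : ∀ {q} {S : Pred C p} {L M H : Pred C q} → (∀ {x} → S x → L x ⊎ M x ⊎ H x) →
             (∀ {x y} → L x → M y → φ ⊢ x ≤ y) → (∀ {x y} → M x → H y → φ ⊢ x ≤ y) →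
             (∀ {x y} → L x → H y → φ ⊢ x ≤ y) → Good L → Good M → Good H → Good S
    Good-⊎ {S = S} {L} {M} {H} split L≤M M≤H L≤H gL gM gH =
      Good-sum true Three-order Three-isWellOrder (λ x sx → tag (split sx))
        (λ sx sy → tag-mono (split sx) (split sy))
        λ { lo → Good-⊆ (λ { (sx , e) → fromLo (split sx) e }) gL
          ; mid → Good-⊆ (λ { (sx , e) → fromMid (split sx) e }) gM
          ; hi → Good-⊆ (λ { (sx , e) → fromHi (split sx) e }) gH }
      where
      tag : ∀ {x} → L x ⊎ M x ⊎ H x → Three
      tag (inj₁ _)        = lo
      tag (inj₂ (inj₁ _)) = mid
      tag (inj₂ (inj₂ _)) = hi

      tag-mono : ∀ {x y} (s : L x ⊎ M x ⊎ H x) (t : L y ⊎ M y ⊎ H y) → φ ⊢ x < y → ¬ tag t <₃ tag s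
      tag-mono (inj₂ (inj₁ m)) (inj₁ l)        x<y _ = L≤M l m x<y
      tag-mono (inj₂ (inj₂ h)) (inj₁ l)        x<y _ = L≤H l h x<y
      tag-mono (inj₂ (inj₂ h)) (inj₂ (inj₁ m)) x<y _ = M≤H m h x<y
      tag-mono (inj₁ _)        (inj₁ _)        _ ()
      tag-mono (inj₁ _)        (inj₂ (inj₁ _)) _ ()
      tag-mono (inj₁ _)        (inj₂ (inj₂ _)) _ ()
      tag-mono (inj₂ (inj₁ _)) (inj₂ (inj₁ _)) _ ()
      tag-mono (inj₂ (inj₁ _)) (inj₂ (inj₂ _)) _ ()
      tag-mono (inj₂ (inj₂ _)) (inj₂ (inj₂ _)) _ ()

      fromLo : ∀ {x} (s : L x ⊎ M x ⊎ H x) → tag s ≡ lo → L x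
      fromLo (inj₁ l) _ = l
      fromLo (inj₂ (inj₁ _)) ()
      fromLo (inj₂ (inj₂ _)) ()

      fromMid : ∀ {x} (s : L x ⊎ M x ⊎ H x) → tag s ≡ mid → M x
      fromMid (inj₂ (inj₁ m)) _ = m
      fromMid (inj₁ _) ()
      fromMid (inj₂ (inj₂ _)) ()

      fromHi : ∀ {x} (s : L x ⊎ M x ⊎ H x) → tag s ≡ hi → H x
      fromHi (inj₂ (inj₂ h)) _ = h
      fromHi (inj₁ _) ()
      fromHi (inj₂ (inj₁ _)) ()

    -- For the empty relation the construction is the well-ordering theorem.
    module _ {A : Set ℓ} where
      open WellOrdering {A = A} (λ _ _ → Lift ℓ ⊥) (λ _ → acc λ ()) public
        using () renaming (≺-order to wellOrdering; ≺-wf to wellOrdering-wf)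

    -- The subtree below a branch is the same for all labels, so every label j receives a
    -- copy of a single tree that has all the fibres as children, and uses only its own.
    Good-small : {S : Pred C p} (J : LinearOrder ℓ) → J ↪ U → (m : ∀ x → S x → Carrier J) →
                 (∀ {x y} sx sy → φ ⊢ x < y → J ⊢ m x sx ≤ m y sy) →
                 (∀ j → Good (λ x → Σ[ sx ∈ S x ] m x sx ≡ j)) → Good S
    Good-small {S = S} J (g , g-mono) m m-mono fibres =
      node One One-isWellOrder trunk , (λ x sx → place (m x sx) x (sx , refl)) ,
      λ sx sy x<y → glue sx refl sy refl x<y (LinearOrder.compare J _ _)
      where
      c : Carrier J → Tree
      c j = proj₁ (fibres j)

      fan : Tree
      fan = node wellOrdering wellOrdering-wf c

      trunk : Carrier (One {ℓ}) → Tree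
      trunk _ = fan

      place : ∀ j x → (Σ[ sx ∈ S x ] m x sx ≡ j) → Carrier (join One trunk)
      place j x s = down {One} trunk (true , g j) _ (down {wellOrdering} c (true , u₀) j (proj₁ (proj₂ (fibres j)) x s))

      glue : ∀ {x y i j} (sx : S x) (p : m x sx ≡ i) (sy : S y) (q : m y sy ≡ j) → φ ⊢ x < y →
             Tri (J ⊢ i < j) (i ≡ j) (J ⊢ j < i) → join One trunk ⊢ place i x (sx , p) < place j y (sy , q)
      glue _  _    _  _    _   (tri< i<j _ _)  = down-label {One} trunk true (g-mono i<j)
      glue {i = i} sx p sy q x<y (tri≈ _ refl _) = down-inner {One} trunk true
        (down-inner {wellOrdering} c true (proj₂ (proj₂ (fibres i)) (sx , p) (sy , q) x<y))
      glue sx refl sy refl x<y (tri> _ _ j<i)  = ⊥-elim (m-mono sx sy x<y j<i)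

    Between : C → C → Pred C ℓ
    Between x y z = (φ ⊢ x ≤ z × φ ⊢ z ≤ y) ⊎ (φ ⊢ y ≤ z × φ ⊢ z ≤ x)

    infix 4 _~_
    _~_ : C → C → Set (lsuc ℓ)
    x ~ y = Good (Between x y)

    total : ∀ x y → φ ⊢ x ≤ y ⊎ φ ⊢ y ≤ x
    total x y with compare x y
    ... | tri< x<y _ _  = inj₁ (<⇒≤ φ x<y)
    ... | tri≈ x≮y _ y≮x = inj₁ y≮x
    ... | tri> _ _ y<x  = inj₂ (<⇒≤ φ y<x)

    Between-swap : ∀ {x y z} → Between x y z → Between y x z
    Between-swap = [ inj₂ , inj₁ ]′

    Between-≤ : ∀ {x y z} → φ ⊢ x ≤ y → Between x y z → φ ⊢ x ≤ z × φ ⊢ z ≤ y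
    Between-≤ _   (inj₁ b)           = b
    Between-≤ x≤y (inj₂ (y≤z , z≤x)) = ≤-trans φ x≤y y≤z , ≤-trans φ z≤x x≤y

    ~-refl : ∀ {x} → x ~ x
    ~-refl = Good-antichain λ bx by x<y →
      let _ , y≤ = Between-≤ (<-irrefl φ) by ; ≤x , _ = Between-≤ (<-irrefl φ) bx in ≤-trans φ y≤ ≤x x<y

    ~-sym : ∀ {x y} → x ~ y → y ~ x
    ~-sym = Good-⊆ Between-swap

    -- The interval is cut at `y`. The same cut works when `y` lies outside it, since the pieces
    -- only have to cover.
    ~-trans : ∀ {x y z} → x ~ y → y ~ z → x ~ z
    ~-trans {x} {y} {z} x~y y~z = [ (λ x≤z → ordered x≤z x~y y~z)
                                  , (λ z≤x → ~-sym (ordered z≤x (~-sym y~z) (~-sym x~y))) ]′ (total x z)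
      where
      ordered : ∀ {x z} → φ ⊢ x ≤ z → x ~ y → y ~ z → x ~ z
      ordered {x} {z} x≤z x~y y~z = Good-⊎ {L = λ u → φ ⊢ x ≤ u × φ ⊢ u < y} {M = λ u → u ≡ y}
        {H = λ u → φ ⊢ y < u × φ ⊢ u ≤ z} (split ∘ Between-≤ x≤z)
        (λ { (_ , u<y) refl → <⇒≤ φ u<y }) (λ { refl (y<u , _) → <⇒≤ φ y<u })
        (λ { (_ , u<y) (y<v , _) → <⇒≤ φ (LinearOrder.trans φ u<y y<v) })
        (Good-⊆ (λ { (x≤u , u<y) → inj₁ (x≤u , <⇒≤ φ u<y) }) x~y)
        (Good-antichain λ { refl refl → <-irrefl φ })
        (Good-⊆ (λ { (y<u , u≤z) → inj₁ (<⇒≤ φ y<u , u≤z) }) y~z)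
        where
        split : ∀ {u} → φ ⊢ x ≤ u × φ ⊢ u ≤ z → (φ ⊢ x ≤ u × φ ⊢ u < y) ⊎ u ≡ y ⊎ (φ ⊢ y < u × φ ⊢ u ≤ z)
        split {u} (x≤u , u≤z) with compare u y
        ... | tri< u<y _ _ = inj₁ (x≤u , u<y)
        ... | tri≈ _ u≡y _ = inj₂ (inj₁ u≡y)
        ... | tri> _ _ y<u = inj₂ (inj₂ (y<u , u≤z))

    ~-convex : ∀ {x y z} → φ ⊢ x ≤ z → φ ⊢ z ≤ y → x ~ y → x ~ z
    ~-convex x≤z z≤y = Good-⊆ λ bu →
      let x≤u , u≤z = Between-≤ x≤z bu in inj₁ (x≤u , ≤-trans φ u≤z z≤y)

    pick : (Q : Pred C p) → Σ C Q → Σ[ x ∈ C ] Q x × (∀ {y} → Q y → wellOrdering ⊢ x ≤ y)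
    pick = least wellOrdering wellOrdering-wf

    module _ (x : C) where

      -- The first element of the class, in the well-ordering, that is at least (at most) y.
      -- These elements are cofinal (coinitial) in the class and depend monotonically on y.
      ceiling : ∀ y → x ~ y → Σ[ z ∈ C ] (x ~ z × φ ⊢ y ≤ z) × (∀ {v} → x ~ v × φ ⊢ y ≤ v → wellOrdering ⊢ z ≤ v)
      ceiling y x~y = pick _ (y , x~y , <-irrefl φ)

      floor : ∀ y → x ~ y → Σ[ z ∈ C ] (x ~ z × φ ⊢ z ≤ y) × (∀ {v} → x ~ v × φ ⊢ v ≤ y → wellOrdering ⊢ z ≤ v)
      floor y x~y = pick _ (y , x~y , <-irrefl φ)

      -- Points with the same ceiling `z` lie between `x` and `z`, which is good because `x ~ z`;
      -- these fibres are summed along the well-ordering.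
      Good-above : Good (λ y → φ ⊢ x < y × x ~ y)
      Good-above = Good-sum true wellOrdering wellOrdering-wf (λ { y (_ , x~y) → proj₁ (ceiling y x~y) })
        (λ { {y} {y′} (_ , x~y) (_ , x~y′) y<y′ →
             let _ , (x~z , y′≤z) , _ = ceiling y′ x~y′ in
             proj₂ (proj₂ (ceiling y x~y)) (x~z , ≤-trans φ (<⇒≤ φ y<y′) y′≤z) })
        λ w → Good-inhabited λ { {y} ((_ , x~y) , refl) →
          Good-⊆ (λ { {v} ((x<v , x~v) , e) →
                   inj₁ (<⇒≤ φ x<v , subst (φ ⊢ v ≤_) e (proj₂ (proj₁ (proj₂ (ceiling v x~v))))) })
                 (proj₁ (proj₁ (proj₂ (ceiling y x~y)))) }

      -- Floors move forward in the well-ordering as points descend, hence the reversed sum.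
      Good-below : Good (λ y → φ ⊢ y < x × x ~ y)
      Good-below = Good-sum false wellOrdering wellOrdering-wf (λ { y (_ , x~y) → proj₁ (floor y x~y) })
        (λ { {y} {y′} (_ , x~y) (_ , x~y′) y<y′ →
             let _ , (x~z , z≤y) , _ = floor y x~y in
             proj₂ (proj₂ (floor y′ x~y′)) (x~z , ≤-trans φ z≤y (<⇒≤ φ y<y′)) })
        λ w → Good-inhabited λ { {y} ((_ , x~y) , refl) →
          Good-⊆ (λ { {v} ((v<x , x~v) , e) →
                   inj₂ (subst (φ ⊢_≤ v) e (proj₂ (proj₁ (proj₂ (floor v x~v)))) , <⇒≤ φ v<x) })
                 (proj₁ (proj₁ (proj₂ (floor y x~y)))) }

      Good-class : Good (x ~_)
      Good-class = Good-⊎ {L = λ y → φ ⊢ y < x × x ~ y} {M = λ y → Lift (lsuc ℓ) (y ≡ x)} {H = λ y → φ ⊢ x < y × x ~ y}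
        split (λ { (y<x , _) (lift refl) → <⇒≤ φ y<x }) (λ { (lift refl) (x<y , _) → <⇒≤ φ x<y })
        (λ { (y<x , _) (x<z , _) → <⇒≤ φ (LinearOrder.trans φ y<x x<z) })
        Good-below (Good-antichain λ { (lift refl) (lift refl) → <-irrefl φ }) Good-above
        where
        split : ∀ {y} → x ~ y → (φ ⊢ y < x × x ~ y) ⊎ Lift (lsuc ℓ) (y ≡ x) ⊎ (φ ⊢ x < y × x ~ y)
        split {y} x~y with compare y x
        ... | tri< y<x _ _ = inj₁ (y<x , x~y)
        ... | tri≈ _ y≡x _ = inj₂ (inj₁ (lift y≡x))
        ... | tri> _ _ x<y = inj₂ (inj₂ (x<y , x~y))

    rep : C → C
    rep x = proj₁ (pick (x ~_) (x , ~-refl))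

    ~-rep : ∀ x → x ~ rep x
    ~-rep x = proj₁ (proj₂ (pick (x ~_) (x , ~-refl)))

    rep-cong : ∀ {x y} → x ~ y → rep x ≡ rep y
    rep-cong {x} {y} x~y = ≤-antisym wellOrdering
      (proj₂ (proj₂ (pick (x ~_) (x , ~-refl))) (~-trans x~y (~-rep y)))
      (proj₂ (proj₂ (pick (y ~_) (y , ~-refl))) (~-trans (~-sym x~y) (~-rep x)))

    rep-reflects-~ : ∀ {x y} → rep x ≡ rep y → x ~ y
    rep-reflects-~ {x} {y} e = ~-trans (~-rep x) (subst (_~ y) (sym e) (~-sym (~-rep y)))

    -- By convexity of classes, an inversion of the representatives would force `x ~ y`, and then
    -- they coincide.
    rep-mono : ∀ {x y} → φ ⊢ x ≤ y → φ ⊢ rep x ≤ rep y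
    rep-mono {x} {y} x≤y ry<rx = <-irrefl φ (subst (φ ⊢_< rep x) (sym (rep-cong x~y)) ry<rx)
      where
      x~y : x ~ y
      x~y = [ (λ ry≤x → ~-sym (~-trans (~-rep y)
                (~-convex ry≤x x≤y (~-sym (~-rep y)) )))
            , (λ x≤ry → ~-trans (~-convex x≤ry (<⇒≤ φ ry<rx) (~-rep x)) (~-sym (~-rep y))) ]′
            (total (rep y) x)

    rep-reflects-≤ : ∀ {x y} → φ ⊢ rep x < rep y → φ ⊢ x ≤ y
    rep-reflects-≤ rx<ry y<x = rep-mono (<⇒≤ φ y<x) rx<ry

    reps : Subset C
    reps = record { member = λ x → rep x ≡ x ; irrelevant = uip }

    toRep : C → Elements reps
    toRep x = rep x , sym (rep-cong (~-rep x))

    module _ (κ : Cardinal ℓ) (small⇒↪U : ∀ J → ¬ (∣ κ ∣ ↣ Carrier J) → J ↪ U) where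

      Interval : ∀ a b → LinearOrder ℓ
      Interval a b = suborder (suborder φ reps) (LinearOrder.OpenInterval (suborder φ reps) a b)

      module _ {a b : C} (ra : rep a ≡ a) (rb : rep b ≡ b) (a<b : φ ⊢ a < b)
               (small : ¬ (∣ κ ∣ ↣ Carrier (Interval (a , ra) (b , rb)))) where

        Inside : Pred C ℓ
        Inside z = φ ⊢ a < rep z × φ ⊢ rep z < b

        -- The classes strictly between are indexed by an order into which κ does not inject, so it
        -- embeds in `U` and the classes can be summed along it.
        Good-inside : Good Inside
        Good-inside = Good-small (Interval (a , ra) (b , rb)) (small⇒↪U (Interval (a , ra) (b , rb)) small)
          (λ z inside → toRep z , inside) (λ _ _ z<z′ → rep-mono (<⇒≤ φ z<z′))
          λ { ((w , _) , _) → Good-⊆ (λ { {z} (_ , e) → ~-sym (subst (z ~_) (cong (proj₁ ∘ proj₁) e) (~-rep z)) })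
                                     (Good-class w) }

        small⇒~ : a ~ b
        small⇒~ = Good-⊎ {L = λ z → rep z ≡ a} {M = Inside} {H = λ z → rep z ≡ b} (split ∘ Between-≤ (<⇒≤ φ a<b))
          (λ { refl (ra<rz , _) → rep-reflects-≤ ra<rz }) (λ { (_ , rz<rb) refl → rep-reflects-≤ rz<rb })
          (λ { refl refl → rep-reflects-≤ a<b })
          (Good-⊆ (λ { refl → ~-sym (~-rep _) }) (Good-class a))
          Good-inside
          (Good-⊆ (λ { refl → ~-sym (~-rep _) }) (Good-class b))
          where
          split : ∀ {z} → φ ⊢ a ≤ z × φ ⊢ z ≤ b → rep z ≡ a ⊎ Inside z ⊎ rep z ≡ b
          split {z} (a≤z , z≤b) =
            [ (λ a<rz → [ (λ rz<b → inj₂ (inj₁ (a<rz , rz<b))) , inj₂ ∘ inj₂ ]′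
                        (≤⇒<⊎≡ φ (subst (φ ⊢ rep z ≤_) rb (rep-mono z≤b))))
            , inj₁ ∘ sym ]′ (≤⇒<⊎≡ φ (subst (φ ⊢_≤ rep z) ra (rep-mono a≤z)))

      -- Two inequivalent points would make `reps` κ-dense: an interval of it that is too small
      -- makes its endpoints equivalent, hence equal.
      ~-full : Scattered κ φ → ∀ x y → x ~ y
      ~-full scattered x y = stable λ x≁y → scattered
        (reps , (toRep x , toRep y , x≁y ∘ rep-reflects-~ ∘ cong proj₁) ,
         λ { (a , ra) (b , rb) a<b → stable λ small →
             <-irrefl φ (subst (φ ⊢_< b) (trans (sym ra) (trans (rep-cong (small⇒~ ra rb a<b small)) rb)) a<b) })

      embed : Scattered κ φ → Σ[ t ∈ Tree ] φ ↪ ⟦ t ⟧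
      embed scattered =
        let t , e , e-mono = Good-inhabited {S = λ _ → ⊤} λ {x} _ → Good-⊆ (λ {y} _ → ~-full scattered x y) (Good-class x)
        in t , (λ x → e x tt) , e-mono tt tt

  -- The partition relation.

  module Partition (κ : Cardinal ℓ) (infinite : Infinite κ) (κ^<κ↔κ : (κ ^< κ) ↔ ∣ κ ∣)
                   (φ : LinearOrder ℓ) (scattered : Scattered κ φ) (ν : Cardinal ℓ) where
    open Coding κ infinite κ^<κ↔κ
    open Trees Universal

    encodeLabel : Label → ∣ κ ∣
    encodeLabel (b , u) = pair (bit (T b)) (encodeUniversal u)

    encodeLabel-injective : ∀ {δ ε} → encodeLabel δ ≡ encodeLabel ε → δ ≡ ε
    encodeLabel-injective {b , u} {c , v} eq = cong₂ _,_
      (T-injective (bit-transfer b≡c) (bit-transfer (sym b≡c))) (encodeUniversal-injective u≡v)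
      where
      b≡c = proj₁ (pair-injective eq)
      u≡v = proj₂ (pair-injective eq)

    -- Several label sequences may give the same colour, hence the truncation.
    colours : Palette ∣ ν ∣ → Subset ∣ ν ∣
    colours χ = record
      { member     = λ c → ∥ Σ[ δs ∈ List Label ] colour χ δs ≡ c ∥
      ; irrelevant = ∥∥-irrelevant
      }

    colours-small : ∀ χ → Elements (colours χ) ↣ ∣ κ ∣
    colours-small χ = mk↣ {to = λ { (_ , m) → encodeList encodeLabel (proj₁ (choose m)) }}
      λ { {_ , m} {_ , n} eq → element-≡ (colours χ)
          (trans (sym (proj₂ (choose m))) (trans
            (cong (colour χ) (encodeList-injective encodeLabel encodeLabel-injective (proj₁ (choose m)) (proj₁ (choose n)) eq))
            (proj₂ (choose n)))) }

    -- The colouring is pulled back to `⟦ s ⟧`. Along the canonical copy of `⟦ t ⟧`, the colour of a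
    -- point is read off `χ` at its address in `t`.
    partition : ∀ s t → φ ↪ ⟦ t ⟧ → (∀ (F : Colouring s ∣ ν ∣) → Σ[ χ ∈ Palette ∣ ν ∣ ] Canonical t s F χ) →
                ⟦ s ⟧ ⟶[ φ ]¹⟨ ν ⨾ κ ⟩
    partition s t i canonical P P≅s f =
      colours χ , image φ P e , colours-small χ , image-≅ φ P e ,
      λ { _ (x , refl) → ∣ address t (proj₁ i x) , sym (canonical-colour t s r (proj₁ i x)) ∣₁ }
      where
      back : ⟦ s ⟧ ↪ P
      back = ≅⇒↪ P ⟦ s ⟧ P≅s

      χ : Palette ∣ ν ∣
      χ = proj₁ (canonical (f ∘ proj₁ back))

      r : Canonical t s (f ∘ proj₁ back) χ
      r = proj₂ (canonical (f ∘ proj₁ back))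

      e : φ ↪ P
      e = ↪-trans φ ⟦ t ⟧ P i
            (↪-trans ⟦ t ⟧ ⟦ s ⟧ P (canonical-map t s r , canonical-mono t s r) back)

    -- κ has two distinct elements, so a one-point order is small.
    u₀ : Carrier Universal
    u₀ = proj₁ (small⇒↪Universal One λ f → k₀≢k₁ (Injection.injective f refl)) _

    target : Σ[ t ∈ Tree ] φ ↪ ⟦ t ⟧
    target = Hausdorff.embed Universal u₀ φ κ small⇒↪Universal scattered

    t : Tree
    t = proj₁ target

    -- The initial demand is constant: whatever the palette, `t` itself is to be found.
    source : Σ[ s ∈ Tree ] ∀ (F : Colouring s ∣ ν ∣) → Σ[ χ ∈ Palette ∣ ν ∣ ] Canonical t s F χ
    source = realize (λ _ → t) (allTerminate _)

    ψ : LinearOrder ℓ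
    ψ = ⟦ proj₁ source ⟧

    ψ-scattered : Scattered κ ψ
    ψ-scattered = DenseFree⇒Scattered κ ψ (⟦⟧-DenseFree κ (proj₁ k₀) Universal-DenseFree (proj₁ source))

    ψ-partition : ψ ⟶[ φ ]¹⟨ ν ⨾ κ ⟩
    ψ-partition = partition (proj₁ source) t (proj₂ target) (proj₂ source)

theorem6p2 : (∀ {a} → ExcludedMiddle a) →
    (∀ {a b} → Extensionality a b) →
    ∀ {ℓ} (κ : Cardinal ℓ) → Infinite κ → (κ ^< κ) ↔ ∣ κ ∣ →
    (φ : LinearOrder ℓ) → Scattered κ φ →
    (ν : Cardinal ℓ) →
    Σ[ ψ ∈ LinearOrder ℓ ] (Scattered κ ψ × ψ ⟶[ φ ]¹⟨ ν ⨾ κ ⟩)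
theorem6p2 em ext κ infinite κ^<κ↔κ φ scattered ν = ψ , ψ-scattered , ψ-partition
  where open Partition em ext κ infinite κ^<κ↔κ φ scattered ν
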